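{- Let $\|\cdot\|$ be an arbitrary seminorm on $\mathbb{R}^n$, and let $\gamma>0$, $\alpha\ge 1$ and $i\in\mathbb{N}$ be constants. Then there is a class $\mathfrak{C}$ consisting of a single (infinite) sequence of cost functions such that, for every deterministic or randomized online algorithm $A$, either $R_i(A)=\Omega(T)$, or, for all sufficiently large $T$, both $CR^\alpha_{i+1}(A)\ge\gamma$ and $CD^\alpha_{i+1}(A)\ge\gamma T$.
   Context: Smoothed online convex optimization (SOCO): a convex decision space $F\subseteq(\mathbb{R}^+)^n$ and a seminorm $\|\cdot\|$ on $\mathbb{R}^n$ are fixed. An online (possibly randomized) algorithm $A$ faces a sequence of cost functions $c^1,c^2,\dots$ with $c^t:F\to\mathbb{R}^+$, and produces decisions $x^1,x^2,\dots\in F$, where $x^s$ may depend only on $c^1,\dots,c^{s-1}$ and on the algorithm's internal randomness. For $\alpha\ge 0$ and lookahead $i\in\mathbb{N}$, the $\alpha$-penalized cost with lookahead $i$ over horizon $T$ is $C_i^\alpha(A)=\mathbb{E}\big[\sum_{t=1}^T c^t(x^{t+i})+\alpha\|x^{t+i}-x^{t+i-1}\|\big]$, with initial action $x^i=0$ and expectation over the algorithm's randomness; write $C_i=C_i^1$. The static optimum is $OPT_s=\min_{x\in F}\sum_{t=1}^T c^t(x)$, and for $\alpha\ge1$ the $\alpha$-unfair dynamic optimum is $OPT_d^\alpha=\min_{(x^1,\dots,x^T)\in F^T}\sum_{t=1}^T c^t(x^t)+\alpha\|x^t-x^{t-1}\|$ (with $x^0=0$). For a class $\mathfrak{C}$ of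 cost functions: the regret $R_i(A)$ is (at most) $\rho(T)$ if for every sequence $(c^1,\dots,c^T)\in\mathfrak{C}^T$, $C_i^0(A)-OPT_s\le\rho(T)$; the $\alpha$-unfair competitive ratio $CR_i^\alpha(A)$ is $\rho(T)$ if for every such sequence $C_i(A)\le\rho(T)\,OPT_d^\alpha+O(1)$; the $\alpha$-unfair competitive difference $CD_i^\alpha(A)$ is $\rho(T)$ if for every such sequence $C_i(A)-OPT_d^\alpha\le\rho(T)$. Statements such as $R_i(A)=\Omega(T)$ or $CR_i^\alpha(A)\ge\gamma$ refer to the best (smallest) $\rho(T)$ for which the corresponding guarantee holds over $\mathfrak{C}$.
   Formalization: Here F is assumed to have at least two points (the claim fails for one point), and R_i(A)=Ω(T) means that the best ρ(T) is at least εT for some ε>0 and arbitrarily large T (not for all large T, which an algorithm alternating between long phases refutes). -}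

module Defs where

open import Algebra.Bundles using (CommutativeRing)
import Algebra.Construct.NaturalChoice.Max as NaturalMax
import Algebra.Definitions.RawMonoid as RawMonoidDefinitions
open import Data.Fin.Base using (Fin; toℕ; inject₁)
open import Data.Nat.Base as ℕ using (ℕ)
open import Data.Product.Base using (∃; ∃₂; Σ-syntax; ∃-syntax; _×_; _,_; proj₁; proj₂)
open import Data.Vec.Functional using (Vector; _∷_)
open import Function.Base using (_∘_)
open import Level using (0ℓ; suc)
open import Relation.Binary.Bundles using (TotalOrder)
open import Relation.Binary.Core using (Rel)
open import Relation.Binary.PropositionalEquality.Core using (_≢_)
open import Relation.Binary.Structures using (IsTotalOrder)
open import Relation.Nullary.Negation.Core using (¬_)
open import Relation.Unary using (Pred; U; ∁; ⋃; _≐_; _⊥_)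

-- The real numbers, characterised up to isomorphism as a Dedekind-complete
-- totally ordered field.  `sup` is total, but only its values on nonempty sets
-- bounded above are constrained.
record CompleteOrderedField : Set₁ where
  infix 4 _≤_ _<_
  field
    commutativeRing : CommutativeRing 0ℓ 0ℓ

  open CommutativeRing commutativeRing public

  field
    _≤_          : Rel Carrier 0ℓ
    isTotalOrder : IsTotalOrder _≈_ _≤_
    0≉1          : ¬ (0# ≈ 1#)
    inverse      : ∀ x → ¬ (x ≈ 0#) → ∃[ y ] x * y ≈ 1#
    +-monoˡ-≤    : ∀ {x y} z → x ≤ y → x + z ≤ y + z
    *-nonneg     : ∀ {x y} → 0# ≤ x → 0# ≤ y → 0# ≤ x * y

  _<_ : Rel Carrier 0ℓ
  x < y = x ≤ y × ¬ (x ≈ y)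

  UpperBound : ∀ {ℓ} → Pred Carrier ℓ → Pred Carrier ℓ
  UpperBound S u = ∀ s → S s → s ≤ u

  IsLUB : ∀ {ℓ} → Pred Carrier ℓ → Pred Carrier ℓ
  IsLUB S u = UpperBound S u × (∀ v → UpperBound S v → u ≤ v)

  field
    sup       : Pred Carrier 0ℓ → Carrier
    sup-isLUB : ∀ S → ∃ S → ∃ (UpperBound S) → IsLUB S (sup S)

  inf : Pred Carrier 0ℓ → Carrier
  inf S = - sup (λ x → S (- x))

  totalOrder : TotalOrder 0ℓ 0ℓ 0ℓ
  totalOrder = record { isTotalOrder = isTotalOrder }

  open NaturalMax totalOrder public using (_⊔_)

  ∣_∣ : Carrier → Carrier
  ∣ x ∣ = x ⊔ (- x)

  open RawMonoidDefinitions +-rawMonoid public using (sum) renaming (_×_ to _·_)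

module Convexity (ℝ : CompleteOrderedField) (n : ℕ) where
  open CompleteOrderedField ℝ

  V : Set
  V = Vector Carrier n

  infix 4 _≋_
  _≋_ : Rel V 0ℓ
  x ≋ y = ∀ j → x j ≈ y j

  0ᵥ : V
  0ᵥ _ = 0#

  infixl 6 _+ᵥ_ _-ᵥ_
  _+ᵥ_ _-ᵥ_ : V → V → V
  (x +ᵥ y) j = x j + y j
  (x -ᵥ y) j = x j - y j

  infixr 7 _*ᵥ_
  _*ᵥ_ : Carrier → V → V
  (r *ᵥ x) j = r * x j

  mix : Carrier → V → V → V
  mix r x y = r *ᵥ x +ᵥ (1# - r) *ᵥ y

  record Seminorm : Set where
    field
      ‖_‖         : V → Carrier
      ‖‖-cong     : ∀ {x y} → x ≋ y → ‖ x ‖ ≈ ‖ y ‖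
      nonneg      : ∀ x → 0# ≤ ‖ x ‖
      homogeneous : ∀ r x → ‖ r *ᵥ x ‖ ≈ ∣ r ∣ * ‖ x ‖
      triangle    : ∀ x y → ‖ x +ᵥ y ‖ ≤ ‖ x ‖ + ‖ y ‖

  record DecisionSpace : Set₁ where
    field
      F        : Pred V 0ℓ
      F-resp-≋ : ∀ {x y} → x ≋ y → F x → F y
      F-nonneg : ∀ {x} → F x → ∀ j → 0# ≤ x j
      F-convex : ∀ {x y} r → 0# ≤ r → r ≤ 1# → F x → F y → F (mix r x y)

  Nontrivial : DecisionSpace → Set
  Nontrivial D = ∃₂ λ x y → F x × F y × ¬ (x ≋ y)
    where open DecisionSpace D

module Probability (ℝ : CompleteOrderedField) where
  open CompleteOrderedField ℝ

  record ProbabilitySpace : Set₁ where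
    field
      Ω       : Set
      Event   : Pred (Pred Ω 0ℓ) 0ℓ
      Event-≐ : ∀ {A B} → A ≐ B → Event A → Event B
      Event-U : Event U
      Event-∁ : ∀ {A} → Event A → Event (∁ A)
      Event-⋃ : ∀ (A : ℕ → Pred Ω 0ℓ) → (∀ k → Event (A k)) → Event (⋃ ℕ A)

      -- Only the values of ℙ on events are constrained.
      ℙ        : Pred Ω 0ℓ → Carrier
      ℙ-cong   : ∀ {A B} → Event A → A ≐ B → ℙ A ≈ ℙ B
      ℙ-nonneg : ∀ {A} → Event A → 0# ≤ ℙ A
      ℙ-U      : ℙ U ≈ 1#
      ℙ-⋃      : ∀ (A : ℕ → Pred Ω 0ℓ) → (∀ k → Event (A k)) →
                 (∀ {j k} → j ≢ k → A j ⊥ A k) →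
                 IsLUB (λ s → ∃[ m ] s ≈ sum {m} (λ k → ℙ (A (toℕ k)))) (ℙ (⋃ ℕ A))

    Measurable : Pred (Ω → Carrier) 0ℓ
    Measurable X = ∀ r → Event (λ ω → X ω ≤ r)

    -- s is the integral of a nonnegative simple function lying below X
    -- (the simple function is 0 off the union of its pieces).
    record LowerSum (X : Ω → Carrier) (s : Carrier) : Set₁ where
      field
        {m}          : ℕ
        piece        : Fin m → Pred Ω 0ℓ
        value        : Fin m → Carrier
        piece-event  : ∀ k → Event (piece k)
        disjoint     : ∀ {j k} → j ≢ k → piece j ⊥ piece k
        value-nonneg : ∀ k → 0# ≤ value k
        below        : ∀ k ω → piece k ω → value k ≤ X ω
        integral     : s ≈ sum (λ k → value k * ℙ (piece k))

    -- For X ≥ 0, the expectation is the supremum, in [0,∞], of the lower sums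
    -- of X; this is the relation "E[X] ≤ v", which is false for every v when
    -- E[X] = ∞.
    𝔼[_]≤_ : (Ω → Carrier) → Carrier → Set₁
    𝔼[ X ]≤ v = UpperBound (LowerSum X) v

module SOCO (ℝ : CompleteOrderedField) {n : ℕ}
            (N : Convexity.Seminorm ℝ n) (D : Convexity.DecisionSpace ℝ n) where
  open CompleteOrderedField ℝ
  open Convexity ℝ n
  open Probability ℝ public
  open Seminorm N
  open DecisionSpace D

  Decision : Set
  Decision = ∃ F

  -- Convex functions F → [0,∞).
  record Cost : Set where
    field
      cost        : Decision → Carrier
      cost-cong   : ∀ {x y} → proj₁ x ≋ proj₁ y → cost x ≈ cost y
      cost-nonneg : ∀ x → 0# ≤ cost x
      cost-convex : ∀ {x y z} r → 0# ≤ r → r ≤ 1# →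
                    proj₁ z ≋ mix r (proj₁ x) (proj₁ y) →
                    cost z ≤ r * cost x + (1# - r) * cost y

  open Cost public

  -- Sequences are indexed from 0: entry t of a cost sequence is c^{t+1}.
  CostSequence : Set
  CostSequence = ℕ → Cost

  prefix : ∀ {A : Set} → (ℕ → A) → (T : ℕ) → Vector A T
  prefix c T = c ∘ toℕ

  -- `decide s (c^1,…,c^s) ω` is the decision x^{s+1}.
  record Algorithm : Set₁ where
    field
      randomness : ProbabilitySpace

    open ProbabilitySpace randomness public

    field
      decide            : (s : ℕ) → Vector Cost s → Ω → Decision
      decide-measurable : ∀ s h j → Measurable (λ ω → proj₁ (decide s h ω) j)

    decisions : CostSequence → Ω → ℕ → Decision
    decisions c ω s = decide s (prefix c s) ω

  totalCost : ∀ {T} → Vector Cost T → Vector Decision T → Carrier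
  totalCost c y = sum (λ t → cost (c t) (y t))

  -- The action preceding the first one is 0, which need not lie in F.
  switchingCost : ∀ {T} → Vector Decision T → Carrier
  switchingCost y = sum (λ t → ‖ proj₁ (y t) -ᵥ previous (inject₁ t) ‖)
    where previous = 0ᵥ ∷ (proj₁ ∘ y)

  penalizedCost : Carrier → ∀ {T} → Vector Cost T → Vector Decision T → Carrier
  penalizedCost α c y = totalCost c y + α * switchingCost y

  -- C_i^α(A) ≤ v over horizon T.  The cost c^{t+1} is paired with the decision
  -- x^{t+1+i}, i.e. entry t + i of the sequence of decisions.
  C[_,_]_≤_on_until_ : ℕ → Carrier → Algorithm → Carrier → CostSequence → ℕ → Set₁
  C[ i , α ] A ≤ v on c until T =
    𝔼[ (λ ω → penalizedCost α (prefix c T) (prefix (λ t → decisions c ω (t ℕ.+ i)) T)) ]≤ v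
    where open Algorithm A

  -- F is not assumed compact, so the optima are infima; these are minima
  -- whenever the minimum is attained.
  OPTs : CostSequence → ℕ → Carrier
  OPTs c T = inf (λ v → Σ[ x ∈ Decision ] v ≈ totalCost (prefix c T) (λ _ → x))

  OPTd : Carrier → CostSequence → ℕ → Carrier
  OPTd α c T = inf (λ v → Σ[ y ∈ Vector Decision T ] v ≈ penalizedCost α (prefix c T) y)

  Class : Set₁
  Class = Pred CostSequence 0ℓ

  Guarantee : Set₂
  Guarantee = Pred (ℕ → Carrier) (suc 0ℓ)

  Regret≤ : ℕ → Class → Algorithm → Guarantee
  Regret≤ i ℭ A ρ = ∀ c → ℭ c → ∀ T → C[ i , 0# ] A ≤ OPTs c T + ρ T on c until T

  CR≤ : ℕ → Carrier → Class → Algorithm → Guarantee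
  CR≤ i α ℭ A ρ =
    ∃[ K ] ∀ c → ℭ c → ∀ T → C[ i , 1# ] A ≤ ρ T * OPTd α c T + K on c until T

  CD≤ : ℕ → Carrier → Class → Algorithm → Guarantee
  CD≤ i α ℭ A ρ = ∀ c → ℭ c → ∀ T → C[ i , 1# ] A ≤ OPTd α c T + ρ T on c until T

  -- A lower bound on the best ρ for which a guarantee holds is a lower bound on
  -- every such ρ; in particular it holds if no finite ρ is guaranteed.
  BestEventually≥ : Guarantee → (ℕ → Carrier) → Set₁
  BestEventually≥ G g = ∀ ρ → G ρ → ∃[ T₀ ] ∀ T → T₀ ℕ.≤ T → g T ≤ ρ T

  -- Ω(T) in the sense of Hardy and Littlewood, i.e. the negation of o(T) for
  -- the positive part: the best ρ is at least ε T for arbitrarily large T.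
  BestΩT : Guarantee → Set₁
  BestΩT G = ∃[ ε ] 0# < ε ×
    (∀ ρ → G ρ → ∀ T₀ → ∃[ T ] T₀ ℕ.≤ T × T · ε ≤ ρ T)

{-# OPTIONS --safe #-}
module Submission where

-- Choose p, q ∈ F that differ in some coordinate, and alternate between two costs
-- f and g with f(q) = g(p) = 0, f(p) = g(q) = κ and f + g ≥ κ on F.  The decision
-- x^{t+i+1} is judged by c^{t+1} in the regret with lookahead i, but by c^t in the
-- cost with lookahead i + 1.  As c^t + c^{t+1} ≥ κ, the former over horizon T + 1
-- and the latter over horizon T add up to at least κ T.  The better of p and q
-- shows that the static optimum is at most κ (T + 1) / 2, so if the regret is not
-- Ω(T), the cost with lookahead i + 1 is at least about κ T / 4.  The dynamic
-- optimum is O(T) with a constant independent of κ, because alternating between q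
-- and p only costs the movement; hence a large κ gives both lower bounds.

open import Defs
open import Algebra.Bundles using (CommutativeRing; RawRing)
import Algebra.Construct.NaturalChoice.Max as NaturalMax
import Algebra.Properties.Monoid.Mult.TCOptimised as OptimisedMult
import Algebra.Properties.Ring as RingProperties
import Algebra.Properties.Semiring.Mult as SemiringMult
import Algebra.Properties.Semiring.Sum as SemiringSum
import Algebra.Solver.Ring as RingSolver
open import Algebra.Solver.Ring.AlmostCommutativeRing using (fromCommutativeRing; _-Raw-AlmostCommutative⟶_)
import Algebra.Solver.Ring.NaturalCoefficients.Default as SemiringSolver
open import Axiom.ExcludedMiddle using (ExcludedMiddle)
open import Data.Empty using (⊥-elim)
open import Data.Fin.Base as Fin using (Fin; toℕ; inject₁)
import Data.Fin.Properties as Fin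
open import Data.Maybe.Base using (Maybe; map)
open import Data.Nat.Base as ℕ using (ℕ; zero; suc)
import Data.Nat.Properties as ℕ
open import Data.Product.Base using (∃; Σ-syntax; ∃-syntax; _×_; _,_; proj₁; proj₂)
open import Data.Sum.Base using (_⊎_; inj₁; inj₂)
open import Data.Unit.Base using (tt)
open import Data.Vec.Functional using (Vector; replicate; _∷_)
open import Function.Base using (_∘_)
open import Level using (0ℓ; Lift; lift; lower) renaming (suc to lsuc)
open import Relation.Binary.Bundles using (TotalOrder)
open import Relation.Binary.Consequences using (dec⇒weaklyDec)
open import Relation.Binary.Definitions using (tri<; tri≈; tri>)
open import Relation.Binary.PropositionalEquality.Core as ≡ using (_≡_; _≢_)
import Relation.Binary.Reasoning.PartialOrder as OrderReasoning
open import Relation.Nullary.Decidable using (Dec; yes; no; map′; decidable-stable)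
open import Relation.Nullary.Negation using (¬_; contradiction)
open import Relation.Unary using (Pred; U; ∁; ⋃; _∩_; _≐_; _⊥_; ｛_｝)

-- Ring solver with integer coefficients.

-- The library solver cancels x − x only if equality of coefficients is decidable,
-- so the coefficients are integers, a − b being represented by (a , b).
module IntegerRingSolver (R : CommutativeRing 0ℓ 0ℓ) where
  open CommutativeRing R
  open RingProperties ring using (-‿+-comm; -‿distribˡ-*; -‿distribʳ-*; -‿involutive; -0#≈0#)
  open SemiringMult semiring using (×-homo-+; ×1-homo-*) renaming (_×_ to _·_)
  open OptimisedMult +-monoid using (×ᵤ≈×) renaming (_×_ to _·′_)
  open SemiringSolver commutativeSemiring using (solve; _:=_; _:+_; _:*_)
  open import Relation.Binary.Reasoning.Setoid setoid

  private
    difference : ℕ × ℕ → Carrier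
    difference (a , b) = a · 1# - b · 1#

    -- Chosen so that (0 , 0) and (1 , 0) evaluate to 0# and 1# definitionally.
    value : ℕ × ℕ → Carrier
    value (a , zero)  = a ·′ 1#
    value (a , suc b) = a ·′ 1# - suc b ·′ 1#

    value≈difference : ∀ c → value c ≈ difference c
    value≈difference (a , zero) = begin
      a ·′ 1#       ≈⟨ ×ᵤ≈× a 1# ⟨
      a · 1#        ≈⟨ +-identityʳ _ ⟨
      a · 1# + 0#   ≈⟨ +-congˡ -0#≈0# ⟨
      a · 1# - 0#   ∎
    value≈difference (a , suc b) = +-cong (sym (×ᵤ≈× a 1#)) (-‿cong (sym (×ᵤ≈× (suc b) 1#)))

    cancel : ℕ → ℕ → ℕ × ℕ
    cancel (suc a) (suc b) = cancel a b
    cancel a       b       = (a , b)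

    difference-cancel : ∀ a b → difference (cancel a b) ≈ a · 1# - b · 1#
    difference-cancel zero    b       = refl
    difference-cancel (suc a) zero    = refl
    difference-cancel (suc a) (suc b) = begin
      difference (cancel a b)
        ≈⟨ difference-cancel a b ⟩
      a · 1# - b · 1#
        ≈⟨ trans (sym (+-identityˡ _)) (+-congʳ (sym (-‿inverseʳ 1#))) ⟩
      1# - 1# + (a · 1# - b · 1#)
        ≈⟨ solve 4 (λ x y z w → x :+ y :+ (z :+ w) := x :+ z :+ (y :+ w)) refl _ _ _ _ ⟩
      1# + a · 1# + (- 1# - b · 1#)
        ≈⟨ +-congˡ (-‿+-comm _ _) ⟩
      suc a · 1# - suc b · 1#
        ∎

    coefficients : RawRing 0ℓ 0ℓ
    coefficients = record
      { Carrier = ℕ × ℕ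
      ; _≈_     = _≡_
      ; _+_     = λ (a , b) (c , d) → cancel (a ℕ.+ c) (b ℕ.+ d)
      ; _*_     = λ (a , b) (c , d) → cancel (a ℕ.* c ℕ.+ b ℕ.* d) (a ℕ.* d ℕ.+ b ℕ.* c)
      ; -_      = λ (a , b) → (b , a)
      ; 0#      = (0 , 0)
      ; 1#      = (1 , 0)
      }
    open RawRing coefficients using () renaming (_+_ to _⊕_; _*_ to _⊗_; -_ to ⊖_)

    difference-+ : ∀ c d → difference (c ⊕ d) ≈ difference c + difference d
    difference-+ (a , b) (c , d) = begin
      difference (cancel (a ℕ.+ c) (b ℕ.+ d))
        ≈⟨ difference-cancel (a ℕ.+ c) (b ℕ.+ d) ⟩
      (a ℕ.+ c) · 1# - (b ℕ.+ d) · 1#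
        ≈⟨ +-cong (×-homo-+ 1# a c) (-‿cong (×-homo-+ 1# b d)) ⟩
      a · 1# + c · 1# - (b · 1# + d · 1#)
        ≈⟨ +-congˡ (-‿+-comm _ _) ⟨
      a · 1# + c · 1# + (- (b · 1#) - d · 1#)
        ≈⟨ solve 4 (λ x y z w → x :+ y :+ (z :+ w) := x :+ z :+ (y :+ w)) refl _ _ _ _ ⟩
      a · 1# - b · 1# + (c · 1# - d · 1#)
        ∎

    -- Both signs are kept as separate atoms x, -y of the semiring identity.
    product-of-differences : ∀ x y z w →
      (x * z + y * w) - (x * w + y * z) ≈ (x - y) * (z - w)
    product-of-differences x y z w = begin
      (x * z + y * w) - (x * w + y * z)
        ≈⟨ +-cong (+-congˡ y*w) (trans (sym (-‿+-comm _ _)) (+-cong (-‿distribʳ-* x w) (-‿distribˡ-* y z))) ⟩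
      (x * z + - y * - w) + (x * - w + - y * z)
        ≈⟨ solve 4 (λ x y z w → (x :* z :+ y :* w) :+ (x :* w :+ y :* z) := (x :+ y) :* (z :+ w)) refl x (- y) z (- w) ⟩
      (x - y) * (z - w)
        ∎
      where
      y*w : y * w ≈ - y * - w
      y*w = begin
        y * w         ≈⟨ -‿involutive _ ⟨
        - - (y * w)   ≈⟨ -‿cong (-‿distribʳ-* y w) ⟩
        - (y * - w)   ≈⟨ -‿distribˡ-* y (- w) ⟩
        - y * - w     ∎

    difference-* : ∀ c d → difference (c ⊗ d) ≈ difference c * difference d
    difference-* (a , b) (c , d) = begin
      difference (cancel (a ℕ.* c ℕ.+ b ℕ.* d) (a ℕ.* d ℕ.+ b ℕ.* c))
        ≈⟨ difference-cancel (a ℕ.* c ℕ.+ b ℕ.* d) (a ℕ.* d ℕ.+ b ℕ.* c) ⟩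
      (a ℕ.* c ℕ.+ b ℕ.* d) · 1# - (a ℕ.* d ℕ.+ b ℕ.* c) · 1#
        ≈⟨ +-cong (dot a c b d) (-‿cong (dot a d b c)) ⟩
      (a · 1# * c · 1# + b · 1# * d · 1#) - (a · 1# * d · 1# + b · 1# * c · 1#)
        ≈⟨ product-of-differences _ _ _ _ ⟩
      (a · 1# - b · 1#) * (c · 1# - d · 1#)
        ∎
      where
      dot : ∀ a c b d → (a ℕ.* c ℕ.+ b ℕ.* d) · 1# ≈ a · 1# * c · 1# + b · 1# * d · 1#
      dot a c b d = trans (×-homo-+ 1# (a ℕ.* c) (b ℕ.* d)) (+-cong (×1-homo-* a c) (×1-homo-* b d))

    difference-neg : ∀ c → difference (⊖ c) ≈ - difference c
    difference-neg (a , b) = begin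
      b · 1# - a · 1#           ≈⟨ +-comm _ _ ⟩
      - (a · 1#) + b · 1#       ≈⟨ +-congˡ (-‿involutive _) ⟨
      - (a · 1#) - - (b · 1#)   ≈⟨ -‿+-comm _ _ ⟩
      - (a · 1# - b · 1#)       ∎

    evaluation : coefficients -Raw-AlmostCommutative⟶ fromCommutativeRing R
    evaluation = record
      { ⟦_⟧    = value
      ; +-homo = λ c d → trans (value≈difference (c ⊕ d))
          (trans (difference-+ c d) (sym (+-cong (value≈difference c) (value≈difference d))))
      ; *-homo = λ c d → trans (value≈difference (c ⊗ d))
          (trans (difference-* c d) (sym (*-cong (value≈difference c) (value≈difference d))))
      ; -‿homo = λ c → trans (value≈difference (⊖ c))
          (trans (difference-neg c) (sym (-‿cong (value≈difference c))))
      ; 0-homo = refl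
      ; 1-homo = refl
      }

    -- The integers a - b and a′ - b′ agree when a + b′ = a′ + b. In the ring, b′ - b′ is inserted,
    -- a + b′ is exchanged for a′ + b, and b - b is dropped.
    value-≟ : ∀ c d → Maybe (value c ≈ value d)
    value-≟ c@(a , b) d@(a′ , b′) = map
      (λ eq → trans (value≈difference c) (trans (cross eq) (sym (value≈difference d))))
      (dec⇒weaklyDec ℕ._≟_ (a ℕ.+ b′) (a′ ℕ.+ b))
      where
      cross : a ℕ.+ b′ ≡ a′ ℕ.+ b → difference c ≈ difference d
      cross eq = begin
        a · 1# - b · 1#
          ≈⟨ trans (sym (+-identityʳ _)) (+-congˡ (sym (-‿inverseʳ (b′ · 1#)))) ⟩
        a · 1# - b · 1# + (b′ · 1# - b′ · 1#)
          ≈⟨ solve 4 (λ x y z w → x :+ y :+ (z :+ w) := (x :+ z) :+ (y :+ w)) refl _ _ _ _ ⟩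
        (a · 1# + b′ · 1#) + (- (b · 1#) - b′ · 1#)
          ≈⟨ +-congʳ (trans (sym (×-homo-+ 1# a b′)) (trans (reflexive (≡.cong (_· 1#) eq)) (×-homo-+ 1# a′ b))) ⟩
        (a′ · 1# + b · 1#) + (- (b · 1#) - b′ · 1#)
          ≈⟨ solve 4 (λ x y z w → (x :+ z) :+ (y :+ w) := x :+ w :+ (z :+ y)) refl _ _ _ _ ⟩
        a′ · 1# - b′ · 1# + (b · 1# - b · 1#)
          ≈⟨ trans (+-congˡ (-‿inverseʳ (b · 1#))) (+-identityʳ _) ⟩
        a′ · 1# - b′ · 1#
          ∎

  open RingSolver coefficients (fromCommutativeRing R) evaluation value-≟ public
    using (Polynomial; con; solve; _:=_; _:+_; _:*_; _:-_; :-_)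

  :0 :1 : ∀ {n} → Polynomial n
  :0 = con (0 , 0)
  :1 = con (1 , 0)

-- Order, Archimedean property and infima in ℝ.

module OrderedField (em : ExcludedMiddle (lsuc 0ℓ)) (ℝ : CompleteOrderedField) where
  open CompleteOrderedField ℝ
  open IntegerRingSolver commutativeRing public
  open TotalOrder totalOrder public using (poset; total; antisym)
    renaming (refl to ≤-refl; trans to ≤-trans; reflexive to ≤-reflexive)
  open NaturalMax totalOrder public using (x≤x⊔y; x≤y⊔x; ⊔-lub; ⊔-cong)
  open SemiringMult semiring public using (×-congʳ; ×-assoc-*)
  open SemiringSum semiring public
    using (sum-cong-≋; sum-cong-≗; sum-replicate; sum-replicate-zero; ∑-distrib-+; *-distribˡ-sum)
  open OrderReasoning poset

  -- Excluded middle is assumed one level higher, where `dichotomy` applies it to guarantees, so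
  -- small propositions are lifted first.
  dec : (P : Set) → Dec P
  dec P = map′ lower lift (em {Lift (lsuc 0ℓ) P})

  by-contradiction : {P : Set} → ¬ ¬ P → P
  by-contradiction = decidable-stable (dec _)

  ≰⇒≥ : ∀ {x y} → ¬ (x ≤ y) → y ≤ x
  ≰⇒≥ {x} {y} x≰y with total x y
  ... | inj₁ x≤y = contradiction x≤y x≰y
  ... | inj₂ y≤x = y≤x

  +-mono-≤ : ∀ {a b c d} → a ≤ b → c ≤ d → a + c ≤ b + d
  +-mono-≤ {a} {b} {c} {d} a≤b c≤d = begin
    a + c   ≤⟨ +-monoˡ-≤ c a≤b ⟩
    b + c   ≈⟨ +-comm b c ⟩
    c + b   ≤⟨ +-monoˡ-≤ b c≤d ⟩
    d + b   ≈⟨ +-comm d b ⟩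
    b + d   ∎

  -- An inequality x ≤ y yields every a ≤ b with b − a ≈ y − x.
  transpose-≤ : ∀ {x y a b} → x ≤ y → a + y ≈ b + x → a ≤ b
  transpose-≤ {x} {y} {a} {b} x≤y eq = begin
    a             ≈⟨ solve 2 (λ a y → a := a :+ y :- y) refl a y ⟩
    a + y - y     ≈⟨ +-congʳ eq ⟩
    b + x - y     ≤⟨ +-monoˡ-≤ (- y) (+-mono-≤ ≤-refl x≤y) ⟩
    b + y - y     ≈⟨ solve 2 (λ b y → b :+ y :- y := b) refl b y ⟩
    b             ∎

  halve-≤ : ∀ {x y} → x + x ≤ y + y → x ≤ y
  halve-≤ {x} {y} 2x≤2y with total x y
  ... | inj₁ x≤y = x≤y
  ... | inj₂ y≤x = transpose-≤ (≤-trans 2x≤2y (+-monoˡ-≤ y y≤x))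
    (solve 2 (λ x y → x :+ (x :+ y) := y :+ (x :+ x)) refl x y)

  +-nonneg : ∀ {x y} → 0# ≤ x → 0# ≤ y → 0# ≤ x + y
  +-nonneg {x} {y} 0≤x 0≤y = transpose-≤ (+-mono-≤ 0≤x 0≤y)
    (solve 2 (λ x y → :0 :+ (x :+ y) := x :+ y :+ (:0 :+ :0)) refl x y)

  *-monoˡ-≤ : ∀ {c a b} → 0# ≤ c → a ≤ b → c * a ≤ c * b
  *-monoˡ-≤ {c} {a} {b} 0≤c a≤b = transpose-≤ (*-nonneg 0≤c 0≤b-a)
    (solve 3 (λ a b c → c :* a :+ c :* (b :- a) := c :* b :+ :0) refl a b c)
    where
    0≤b-a : 0# ≤ b - a
    0≤b-a = transpose-≤ a≤b (solve 2 (λ a b → :0 :+ b := b :- a :+ a) refl a b)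

  0≤1 : 0# ≤ 1#
  0≤1 with total 0# 1#
  ... | inj₁ 0≤1 = 0≤1
  ... | inj₂ 1≤0 = transpose-≤ (*-nonneg 0≤-1 0≤-1)
    (solve 0 (:0 :+ (:- :1) :* (:- :1) := :1 :+ :0) refl)
    where
    0≤-1 : 0# ≤ - 1#
    0≤-1 = transpose-≤ 1≤0 (solve 0 (:0 :+ :0 := (:- :1) :+ :1) refl)

  1≰0 : ¬ (1# ≤ 0#)
  1≰0 1≤0 = 0≉1 (antisym 0≤1 1≤0)

  -- Here and below `¬ (x ≤ 0#)` stands for x > 0. An inverse y ≤ 0 would give 1 = x y ≤ 0.
  reciprocal : ∀ {x} → ¬ (x ≤ 0#) → ∃[ y ] x * y ≈ 1# × 0# ≤ y
  reciprocal {x} x≰0 with inverse x (x≰0 ∘ ≤-reflexive)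
  ... | y , xy≈1 with total 0# y
  ... | inj₁ 0≤y = y , xy≈1 , 0≤y
  ... | inj₂ y≤0 = contradiction 1≤0 1≰0
    where
    1≤0 : 1# ≤ 0#
    1≤0 = begin
      1#       ≈⟨ xy≈1 ⟨
      x * y    ≤⟨ *-monoˡ-≤ (≰⇒≥ x≰0) y≤0 ⟩
      x * 0#   ≈⟨ zeroʳ x ⟩
      0#       ∎

  ·-nonneg : ∀ {x} k → 0# ≤ x → 0# ≤ k · x
  ·-nonneg zero    0≤x = ≤-refl
  ·-nonneg (suc k) 0≤x = +-nonneg 0≤x (·-nonneg k 0≤x)

  ·-monoʳ-≤ : ∀ {x y} k → x ≤ y → k · x ≤ k · y
  ·-monoʳ-≤ zero    x≤y = ≤-refl
  ·-monoʳ-≤ (suc k) x≤y = +-mono-≤ x≤y (·-monoʳ-≤ k x≤y)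

  ·-monoˡ-≤ : ∀ {x j k} → 0# ≤ x → j ℕ.≤ k → j · x ≤ k · x
  ·-monoˡ-≤ {k = k} 0≤x ℕ.z≤n       = ·-nonneg k 0≤x
  ·-monoˡ-≤         0≤x (ℕ.s≤s j≤k) = +-mono-≤ ≤-refl (·-monoˡ-≤ 0≤x j≤k)

  ·≈* : ∀ k x → k · x ≈ (k · 1#) * x
  ·≈* k x = sym (trans (×-assoc-* k 1# x) (×-congʳ k (*-identityˡ x)))

  -- If x bounded all multiples of ε, they would have a supremum s. Since (k + 1) ε ≤ s for every k,
  -- s - ε would be an upper bound too, forcing ε ≤ 0.
  archimedean : ∀ x {ε} → ¬ (ε ≤ 0#) → ∃[ k ] ¬ (k · ε ≤ x)
  archimedean x {ε} ε≰0 = by-contradiction λ none →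
    let S = λ y → ∃[ k ] y ≈ k · ε
        bounded k = by-contradiction λ k·ε≰x → none (k , k·ε≰x)
        upper , least = sup-isLUB S (0# , 0 , refl)
          (x , λ { y (k , y≈) → ≤-trans (≤-reflexive y≈) (bounded k) })
        sup-ε-bounds : UpperBound S (sup S - ε)
        sup-ε-bounds = λ { y (k , y≈) → transpose-≤ (upper (suc k · ε) (suc k , refl))
          (trans (+-congʳ y≈) (solve 3 (λ s ε t → t :+ s := s :- ε :+ (ε :+ t)) refl (sup S) ε (k · ε))) }
    in ε≰0 (transpose-≤ (least (sup S - ε) sup-ε-bounds)
         (solve 2 (λ s ε → ε :+ (s :- ε) := :0 :+ s) refl (sup S) ε))

  1+k≰0 : ∀ k → ¬ (suc k · 1# ≤ 0#)
  1+k≰0 k le = 1≰0 (≤-trans (transpose-≤ (·-nonneg k 0≤1)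
    (solve 1 (λ x → :1 :+ x := :1 :+ x :+ :0) refl (k · 1#))) le)

  -- A countable null sequence of positive numbers: strict inequalities become countable unions of
  -- events, and a positive error can be sent to 0.
  1/[1+_] : ℕ → Carrier
  1/[1+ k ] = proj₁ (reciprocal (1+k≰0 k))

  1/[1+]-inverse : ∀ k → (suc k · 1#) * 1/[1+ k ] ≈ 1#
  1/[1+]-inverse k = proj₁ (proj₂ (reciprocal (1+k≰0 k)))

  1/[1+]-positive : ∀ k → ¬ (1/[1+ k ] ≤ 0#)
  1/[1+]-positive k le = 1≰0 (begin
    1#                          ≈⟨ 1/[1+]-inverse k ⟨
    (suc k · 1#) * 1/[1+ k ]    ≤⟨ *-monoˡ-≤ (·-nonneg (suc k) 0≤1) le ⟩
    (suc k · 1#) * 0#           ≈⟨ zeroʳ _ ⟩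
    0#                          ∎)

  -- Take k with k η > 1. Then η ≤ 1/(1 + k) would give k η ≤ (1 + k) η ≤ 1.
  1/[1+]-small : ∀ {η} → ¬ (η ≤ 0#) → ∃[ k ] ¬ (η ≤ 1/[1+ k ])
  1/[1+]-small {η} η≰0 = k , λ η≤ → proj₂ (archimedean 1# η≰0) (begin
    k · η                       ≤⟨ ·-monoˡ-≤ (≰⇒≥ η≰0) (ℕ.n≤1+n k) ⟩
    suc k · η                   ≤⟨ ·-monoʳ-≤ (suc k) η≤ ⟩
    suc k · 1/[1+ k ]           ≈⟨ ·≈* (suc k) 1/[1+ k ] ⟩
    (suc k · 1#) * 1/[1+ k ]    ≈⟨ 1/[1+]-inverse k ⟩
    1#                          ∎)
    where
    k = proj₁ (archimedean 1# η≰0)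

  ≰⇒gap : ∀ {a b} → ¬ (a ≤ b) → ∃[ k ] ¬ (a ≤ b + 1/[1+ k ])
  ≰⇒gap {a} {b} a≰b =
    let k , gap = 1/[1+]-small {a - b} (λ a-b≤0 → a≰b (transpose-≤ a-b≤0
                    (solve 2 (λ a b → a :+ :0 := b :+ (a :- b)) refl a b)))
    in k , λ a≤ → gap (transpose-≤ a≤
         (solve 3 (λ a b e → a :- b :+ (b :+ e) := e :+ a) refl a b 1/[1+ k ]))

  ≤-closed : ∀ {a b} → (∀ k → a ≤ b + 1/[1+ k ]) → a ≤ b
  ≤-closed bounds = by-contradiction λ a≰b →
    let k , gap = ≰⇒gap a≰b in gap (bounds k)

  sum-mono-≤ : ∀ {m} {f g : Vector Carrier m} → (∀ t → f t ≤ g t) → sum f ≤ sum g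
  sum-mono-≤ {zero}  f≤g = ≤-refl
  sum-mono-≤ {suc m} f≤g = +-mono-≤ (f≤g Fin.zero) (sum-mono-≤ (f≤g ∘ Fin.suc))

  sum-nonneg : ∀ {m} {f : Vector Carrier m} → (∀ t → 0# ≤ f t) → 0# ≤ sum f
  sum-nonneg {zero}  0≤f = ≤-refl
  sum-nonneg {suc m} 0≤f = +-nonneg (0≤f Fin.zero) (sum-nonneg (0≤f ∘ Fin.suc))

  -- `inf` is a reflected `sup`, which is constrained only on nonempty sets bounded above. The
  -- member v gives the former and the lower bound 0 of S the latter; `S-resp` is what places - v in
  -- the reflected set.
  module _ (S : Pred Carrier 0ℓ) (S-resp : ∀ {x y} → x ≈ y → S x → S y)
           (0≤S : ∀ v → S v → 0# ≤ v) {v : Carrier} (Sv : S v) where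

    private
      -S = λ x → S (- x)

      -S-bound : UpperBound -S 0#
      -S-bound x S-x = transpose-≤ (0≤S (- x) S-x)
        (solve 1 (λ x → x :+ (:- x) := :0 :+ :0) refl x)

      -S-v : -S (- v)
      -S-v = S-resp (solve 1 (λ v → v := :- (:- v)) refl v) Sv

      -S-lub : IsLUB -S (sup -S)
      -S-lub = sup-isLUB -S (- v , -S-v) (0# , -S-bound)

    inf-≤ : inf S ≤ v
    inf-≤ = transpose-≤ (proj₁ -S-lub (- v) -S-v)
      (solve 2 (λ s v → (:- s) :+ s := v :+ (:- v)) refl (sup -S) v)

    inf-nonneg : 0# ≤ inf S
    inf-nonneg = transpose-≤ (proj₂ -S-lub 0# -S-bound)
      (solve 1 (λ s → :0 :+ :0 := (:- s) :+ s) refl (sup -S))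

-- Measurability and bounds on expectations.

module Expectation (em : ExcludedMiddle (lsuc 0ℓ)) (ℝ : CompleteOrderedField)
                   (P : Probability.ProbabilitySpace ℝ) where
  open CompleteOrderedField ℝ
  open OrderedField em ℝ
  open Probability ℝ using (module ProbabilitySpace)
  open ProbabilitySpace P
  open OrderReasoning poset

  Event-const : (Q : Set) → Event (λ _ → Q)
  Event-const Q with dec Q
  ... | yes q = Event-≐ ((λ _ → q) , (λ _ → tt)) Event-U
  ... | no ¬q = Event-≐ ((λ ¬u → ⊥-elim (¬u tt)) , (λ q → ⊥-elim (¬q q))) (Event-∁ Event-U)

  -- De Morgan: the two complements are padded to a countable family by repeating the second one.
  Event-∩ : ∀ {A B} → Event A → Event B → Event (A ∩ B)
  Event-∩ {A} {B} eA eB = Event-≐ (to , from) (Event-∁ (Event-⋃ complements complements-event))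
    where
    complements : ℕ → Pred Ω 0ℓ
    complements zero    = ∁ A
    complements (suc _) = ∁ B

    complements-event : ∀ k → Event (complements k)
    complements-event zero    = Event-∁ eA
    complements-event (suc _) = Event-∁ eB

    to : ∀ {ω} → ∁ (⋃ ℕ complements) ω → (A ∩ B) ω
    to none = by-contradiction (λ ¬a → none (0 , ¬a)) , by-contradiction (λ ¬b → none (1 , ¬b))

    from : ∀ {ω} → (A ∩ B) ω → ∁ (⋃ ℕ complements) ω
    from (a , b) (zero  , ¬a) = ¬a a
    from (a , b) (suc _ , ¬b) = ¬b b

  measurable-≈ : ∀ {X Y} → (∀ ω → X ω ≈ Y ω) → Measurable X → Measurable Y
  measurable-≈ X≈Y mX r = Event-≐
    ( (λ {ω} X≤r → ≤-trans (≤-reflexive (sym (X≈Y ω))) X≤r)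
    , (λ {ω} Y≤r → ≤-trans (≤-reflexive (X≈Y ω)) Y≤r) ) (mX r)

  measurable-const : ∀ c → Measurable (λ _ → c)
  measurable-const c r = Event-const (c ≤ r)

  measurable-shift : ∀ {X} c → Measurable X → Measurable (λ ω → X ω + c)
  measurable-shift {X} c mX r = Event-≐
    ( (λ {ω} X≤ → transpose-≤ X≤ (solve 3 (λ x c r → x :+ c :+ (r :- c) := r :+ x) refl (X ω) c r))
    , (λ {ω} X+c≤ → transpose-≤ X+c≤ (solve 3 (λ x c r → x :+ r := r :- c :+ (x :+ c)) refl (X ω) c r)) )
    (mX (r - c))

  -- X < r holds exactly if X ≤ r - 1/(1 + k) for some k, so the event is the complement of a
  -- countable union.
  measurable-≥ : ∀ {X} → Measurable X → ∀ r → Event (λ ω → r ≤ X ω)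
  measurable-≥ {X} mX r = Event-≐ (to , from)
    (Event-∁ (Event-⋃ (λ k ω → X ω ≤ r - 1/[1+ k ]) (λ k → mX (r - 1/[1+ k ]))))
    where
    to : ∀ {ω} → ¬ (∃[ k ] X ω ≤ r - 1/[1+ k ]) → r ≤ X ω
    to {ω} none = ≤-closed λ k → transpose-≤ (≰⇒≥ (λ le → none (k , le)))
      (solve 3 (λ r x e → r :+ x := x :+ e :+ (r :- e)) refl r (X ω) 1/[1+ k ])

    from : ∀ {ω} → r ≤ X ω → ¬ (∃[ k ] X ω ≤ r - 1/[1+ k ])
    from {ω} r≤X (k , le) = 1/[1+]-positive k (transpose-≤ (≤-trans r≤X le)
      (solve 2 (λ r e → e :+ (r :- e) := :0 :+ r) refl r 1/[1+ k ]))

  measurable-neg : ∀ {X} → Measurable X → Measurable (λ ω → - X ω)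
  measurable-neg {X} mX r = Event-≐
    ( (λ {ω} le → transpose-≤ le (solve 2 (λ x r → (:- x) :+ x := r :+ (:- r)) refl (X ω) r))
    , (λ {ω} le → transpose-≤ le (solve 2 (λ x r → (:- r) :+ r := x :+ (:- x)) refl (X ω) r)) )
    (measurable-≥ mX (- r))

  measurable-scale⁺ : ∀ {X u} → ¬ (u ≤ 0#) → Measurable X → Measurable (λ ω → u * X ω)
  measurable-scale⁺ {X} {u} u≰0 mX r = Event-≐ (to , from) (mX (w * r))
    where
    w = proj₁ (reciprocal u≰0)
    uw≈1 = proj₁ (proj₂ (reciprocal u≰0))
    0≤w = proj₂ (proj₂ (reciprocal u≰0))

    to : ∀ {ω} → X ω ≤ w * r → u * X ω ≤ r
    to {ω} X≤ = begin
      u * X ω       ≤⟨ *-monoˡ-≤ (≰⇒≥ u≰0) X≤ ⟩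
      u * (w * r)   ≈⟨ *-assoc u w r ⟨
      u * w * r     ≈⟨ *-congʳ uw≈1 ⟩
      1# * r        ≈⟨ *-identityˡ r ⟩
      r             ∎

    from : ∀ {ω} → u * X ω ≤ r → X ω ≤ w * r
    from {ω} uX≤ = begin
      X ω             ≈⟨ *-identityˡ (X ω) ⟨
      1# * X ω        ≈⟨ *-congʳ uw≈1 ⟨
      u * w * X ω     ≈⟨ solve 3 (λ u w x → u :* w :* x := w :* (u :* x)) refl u w (X ω) ⟩
      w * (u * X ω)   ≤⟨ *-monoˡ-≤ 0≤w uX≤ ⟩
      w * r           ∎

  measurable-scale : ∀ {X} u → Measurable X → Measurable (λ ω → u * X ω)
  measurable-scale {X} u mX with dec (u ≤ 0#) | dec (- u ≤ 0#)
  ... | no u≰0  | _        = measurable-scale⁺ u≰0 mX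
  ... | yes _   | no -u≰0  = measurable-≈
    (λ ω → solve 2 (λ u x → :- ((:- u) :* x) := u :* x) refl u (X ω))
    (measurable-neg (measurable-scale⁺ -u≰0 mX))
  ... | yes u≤0 | yes -u≤0 = measurable-≈
    (λ ω → trans (sym (zeroˡ (X ω))) (*-congʳ (antisym 0≤u u≤0))) (measurable-const 0#)
    where
    0≤u : 0# ≤ u
    0≤u = transpose-≤ -u≤0 (solve 1 (λ u → :0 :+ :0 := u :+ (:- u)) refl u)

  measurable-⊔ : ∀ {X} c → Measurable X → Measurable (λ ω → X ω ⊔ c)
  measurable-⊔ {X} c mX r = Event-≐
    ( (λ (X≤r , c≤r) → ⊔-lub X≤r c≤r)
    , (λ {ω} le → ≤-trans (x≤x⊔y (X ω) c) le , ≤-trans (x≤y⊔x (X ω) c) le) )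
    (Event-∩ (mX r) (Event-const (c ≤ r)))

  -- The Archimedean property gives some multiple of ε above x; descending from it as long as
  -- possible finds the least one.
  layer-index : ∀ {x ε} → 0# ≤ x → ¬ (ε ≤ 0#) →
                ∃[ k ] x ≤ k · ε × ¬ (x ≤ k · ε - ε)
  layer-index {x} {ε} 0≤x ε≰0 = search (proj₁ far) (≰⇒≥ (proj₂ far))
    where
    far = archimedean x ε≰0

    search : ∀ k → x ≤ k · ε → ∃[ k ] x ≤ k · ε × ¬ (x ≤ k · ε - ε)
    -- The descent ends at layer 0, which contains only x = 0, because - ε < 0 ≤ x.
    search zero x≤0 = 0 , x≤0 , λ x≤-ε → ε≰0 (transpose-≤ (≤-trans 0≤x x≤-ε)
      (solve 1 (λ e → e :+ (:0 :- e) := :0 :+ :0) refl ε))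
    search (suc k) x≤ with dec (x ≤ k · ε)
    ... | yes x≤k = search k x≤k
    ... | no  x≰k = suc k , x≤ , λ le → x≰k (≤-trans le (≤-reflexive
      (solve 2 (λ e y → e :+ y :- e := y) refl ε (k · ε))))

  -- X + Y > r exactly if, for some grid width e = 1/(1+n) and some k,
  -- X > k e − e and Y > r − (k e − e).
  measurable-+ : ∀ {X Y} → (∀ ω → 0# ≤ X ω) → Measurable X → Measurable Y →
                 Measurable (λ ω → X ω + Y ω)
  measurable-+ {X} {Y} 0≤X mX mY r = Event-≐ (to , from)
    (Event-∁ (Event-⋃ _ λ n → Event-⋃ (λ k → ∁ (XBelow n k) ∩ ∁ (YBelow n k)) λ k →
      Event-∩ (Event-∁ (mX (k · 1/[1+ n ] - 1/[1+ n ])))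
              (Event-∁ (mY (r - (k · 1/[1+ n ] - 1/[1+ n ]))))))
    where
    XBelow YBelow : ℕ → ℕ → Pred Ω 0ℓ
    XBelow n k ω = X ω ≤ k · 1/[1+ n ] - 1/[1+ n ]
    YBelow n k ω = Y ω ≤ r - (k · 1/[1+ n ] - 1/[1+ n ])

    Exceeds : Pred Ω 0ℓ
    Exceeds ω = ∃[ n ] ∃[ k ] (∁ (XBelow n k) ∩ ∁ (YBelow n k)) ω

    to : ∀ {ω} → ¬ Exceeds ω → X ω + Y ω ≤ r
    to {ω} none = by-contradiction λ X+Y≰r →
      let n , gap = ≰⇒gap X+Y≰r
          e       = 1/[1+ n ]
          k , X≤ , X≰ = layer-index (0≤X ω) (1/[1+]-positive n)
      in none (n , k , X≰ , λ Y≤ → gap (transpose-≤ (+-mono-≤ X≤ Y≤)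
           (solve 5 (λ x y r e c → x :+ y :+ (c :+ (r :- (c :- e))) := r :+ e :+ (x :+ y))
              refl (X ω) (Y ω) r e (k · e))))

    from : ∀ {ω} → X ω + Y ω ≤ r → ¬ Exceeds ω
    from {ω} X+Y≤r (n , k , X≰ , Y≰) = Y≰ (transpose-≤ (+-mono-≤ X+Y≤r (≰⇒≥ X≰))
      (solve 4 (λ x y r q → y :+ (r :+ x) := r :- q :+ (x :+ y :+ q))
        refl (X ω) (Y ω) r (k · 1/[1+ n ] - 1/[1+ n ])))

  measurable-sum : ∀ {m} {X : Fin m → Ω → Carrier} → (∀ t ω → 0# ≤ X t ω) →
                   (∀ t → Measurable (X t)) → Measurable (λ ω → sum (λ t → X t ω))
  measurable-sum {zero}  0≤X mX = measurable-const 0#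
  measurable-sum {suc m} 0≤X mX = measurable-+ (0≤X Fin.zero) (mX Fin.zero)
    (measurable-sum (0≤X ∘ Fin.suc) (mX ∘ Fin.suc))

  -- The lower sum without pieces has integral 0.
  𝔼≤-nonneg : ∀ {X v} → 𝔼[ X ]≤ v → 0# ≤ v
  𝔼≤-nonneg 𝔼X≤v = 𝔼X≤v 0# (record
    { m            = 0
    ; piece        = λ ()
    ; value        = λ ()
    ; piece-event  = λ ()
    ; disjoint     = λ { {()} }
    ; value-nonneg = λ ()
    ; below        = λ ()
    ; integral     = refl
    })

  -- On the layer k ε − ε < X ≤ k ε both X ≥ k ε − ε and Y ≥ κ − k ε, so the two
  -- lower sums over the first m layers together have integrand at least κ − ε.
  module Layers {X Y : Ω → Carrier} {κ ε : Carrier} (ε≰0 : ¬ (ε ≤ 0#)) (mX : Measurable X)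
                (0≤X : ∀ ω → 0# ≤ X ω) (0≤Y : ∀ ω → 0# ≤ Y ω)
                (κ≤X+Y : ∀ ω → κ ≤ X ω + Y ω) where

    layer : ℕ → Pred Ω 0ℓ
    layer k ω = X ω ≤ k · ε × ¬ (X ω ≤ k · ε - ε)

    layer-event : ∀ k → Event (layer k)
    layer-event k = Event-∩ (mX (k · ε)) (Event-∁ (mX (k · ε - ε)))

    -- For j < k, X ≤ j ε implies X ≤ k ε - ε, which layer k excludes.
    layer-below : ∀ {j k} → j ℕ.< k → layer j ⊥ layer k
    layer-below {j} {k} j<k {ω} ((X≤j , _) , (_ , X≰k)) = X≰k (≤-trans X≤j
      (transpose-≤ (·-monoˡ-≤ (≰⇒≥ ε≰0) j<k)
        (solve 3 (λ e x y → x :+ y := y :- e :+ (e :+ x)) refl ε (j · ε) (k · ε))))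

    layer-disjoint : ∀ {j k} → j ≢ k → layer j ⊥ layer k
    layer-disjoint {j} {k} j≢k (lj , lk) with ℕ.<-cmp j k
    ... | tri< j<k _ _ = layer-below j<k (lj , lk)
    ... | tri≈ _ j≡k _ = j≢k j≡k
    ... | tri> _ _ k<j = layer-below k<j (lk , lj)

    mass : ∀ m → Vector Carrier m
    mass m k = ℙ (layer (toℕ k))

    -- By `layer-index` the disjoint layers exhaust Ω, so countable additivity makes their masses
    -- add up to 1.
    mass-lub : IsLUB (λ s → ∃[ m ] s ≈ sum (mass m)) 1#
    mass-lub = (λ s s∈ → ≤-trans (proj₁ lub s s∈) (≤-reflexive ℙ-all))
             , (λ v v-bound → ≤-trans (≤-reflexive (sym ℙ-all)) (proj₂ lub v v-bound))
      where
      lub = ℙ-⋃ layer layer-event layer-disjoint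

      ℙ-all : ℙ (⋃ ℕ layer) ≈ 1#
      ℙ-all = trans (ℙ-cong (Event-⋃ layer layer-event)
        ((λ _ → tt) , (λ {ω} _ → layer-index (0≤X ω) ε≰0))) ℙ-U

    -- Lower sums require nonnegative values, hence the truncation at 0; it stays below Z because Z
    -- ≥ 0.
    lowerSum : ∀ {Z : Ω → Carrier} (a : ℕ → Carrier) → (∀ ω → 0# ≤ Z ω) →
               (∀ k ω → layer k ω → a k ≤ Z ω) →
               ∀ m → LowerSum Z (sum (λ k → (a (toℕ k) ⊔ 0#) * mass m k))
    lowerSum a 0≤Z a≤Z m = record
      { m            = m
      ; piece        = layer ∘ toℕ
      ; value        = λ k → a (toℕ k) ⊔ 0#
      ; piece-event  = layer-event ∘ toℕ
      ; disjoint     = λ j≢k → layer-disjoint (j≢k ∘ Fin.toℕ-injective)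
      ; value-nonneg = λ k → x≤y⊔x (a (toℕ k)) 0#
      ; below        = λ k ω l → ⊔-lub (a≤Z (toℕ k) ω l) (0≤Z ω)
      ; integral     = refl
      }

    partial-bound : ∀ {u v} → 𝔼[ X ]≤ u → 𝔼[ Y ]≤ v →
                    ∀ m → κ * sum (mass m) ≤ u + v + ε
    partial-bound {u} {v} 𝔼X≤u 𝔼Y≤v m = begin
      κ * sum (mass m)
        ≈⟨ *-distribˡ-sum κ (mass m) ⟩
      sum (λ k → κ * mass m k)
        ≤⟨ sum-mono-≤ term ⟩
      sum (λ k → a k * mass m k + b k * mass m k + ε * mass m k)
        ≈⟨ ∑-distrib-+ (λ k → a k * mass m k + b k * mass m k) (λ k → ε * mass m k) ⟩
      sum (λ k → a k * mass m k + b k * mass m k) + sum (λ k → ε * mass m k)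
        ≈⟨ +-cong (∑-distrib-+ (λ k → a k * mass m k) (λ k → b k * mass m k))
                  (sym (*-distribˡ-sum ε (mass m))) ⟩
      sum (λ k → a k * mass m k) + sum (λ k → b k * mass m k) + ε * sum (mass m)
        ≤⟨ +-mono-≤ (+-mono-≤ (𝔼X≤u _ lowerX) (𝔼Y≤v _ lowerY))
             (*-monoˡ-≤ (≰⇒≥ ε≰0) (proj₁ mass-lub _ (m , refl))) ⟩
      u + v + ε * 1#
        ≈⟨ +-congˡ (*-identityʳ ε) ⟩
      u + v + ε
        ∎
      where
      a b : Fin m → Carrier
      a k = (toℕ k · ε - ε) ⊔ 0#
      b k = (κ - toℕ k · ε) ⊔ 0#

      lowerX : LowerSum X (sum (λ k → a k * mass m k))
      lowerX = lowerSum (λ k → k · ε - ε) 0≤X (λ k ω (_ , X≰) → ≰⇒≥ X≰) m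

      lowerY : LowerSum Y (sum (λ k → b k * mass m k))
      lowerY = lowerSum (λ k → κ - k · ε) 0≤Y (λ k ω (X≤ , _) →
        transpose-≤ (+-mono-≤ (κ≤X+Y ω) X≤)
          (solve 4 (λ c d x y → c :- d :+ (x :+ y :+ d) := y :+ (c :+ x)) refl κ (k · ε) (X ω) (Y ω))) m

      -- The untruncated values add up to (k ε - ε) + (κ - k ε) = κ - ε, and truncation can only
      -- increase them.
      κ≤a+b+ε : ∀ k → κ ≤ a k + b k + ε
      κ≤a+b+ε k = transpose-≤ (+-mono-≤ (x≤x⊔y (toℕ k · ε - ε) 0#) (x≤x⊔y (κ - toℕ k · ε) 0#))
        (solve 5 (λ c d e x y → c :+ (x :+ y) := x :+ y :+ e :+ (d :- e :+ (c :- d)))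
          refl κ (toℕ k · ε) ε (a k) (b k))

      term : ∀ k → κ * mass m k ≤ a k * mass m k + b k * mass m k + ε * mass m k
      term k = begin
        κ * mass m k
          ≈⟨ *-comm κ (mass m k) ⟩
        mass m k * κ
          ≤⟨ *-monoˡ-≤ (ℙ-nonneg (layer-event (toℕ k))) (κ≤a+b+ε k) ⟩
        mass m k * (a k + b k + ε)
          ≈⟨ solve 4 (λ p x y e → p :* (x :+ y :+ e) := x :* p :+ y :* p :+ e :* p)
               refl (mass m k) (a k) (b k) ε ⟩
        a k * mass m k + b k * mass m k + ε * mass m k
          ∎

    -- After division by κ > 0, `partial-bound` becomes an upper bound of all partial masses, hence
    -- of their least upper bound 1.
    total-bound : ∀ {u v} → 𝔼[ X ]≤ u → 𝔼[ Y ]≤ v → ¬ (κ ≤ 0#) → κ ≤ u + v + ε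
    total-bound {u} {v} 𝔼X≤u 𝔼Y≤v κ≰0 = begin
      κ                       ≈⟨ *-identityʳ κ ⟨
      κ * 1#                  ≤⟨ *-monoˡ-≤ (≰⇒≥ κ≰0) (proj₂ mass-lub (w * (u + v + ε)) sums-bounded) ⟩
      κ * (w * (u + v + ε))   ≈⟨ *-assoc κ w _ ⟨
      κ * w * (u + v + ε)     ≈⟨ *-congʳ κw≈1 ⟩
      1# * (u + v + ε)        ≈⟨ *-identityˡ _ ⟩
      u + v + ε               ∎
      where
      w = proj₁ (reciprocal κ≰0)
      κw≈1 = proj₁ (proj₂ (reciprocal κ≰0))
      0≤w = proj₂ (proj₂ (reciprocal κ≰0))

      sums-bounded : UpperBound (λ s → ∃[ m ] s ≈ sum (mass m)) (w * (u + v + ε))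
      sums-bounded s (m , s≈) = begin
        s                        ≈⟨ s≈ ⟩
        sum (mass m)             ≈⟨ *-identityˡ _ ⟨
        1# * sum (mass m)        ≈⟨ *-congʳ κw≈1 ⟨
        κ * w * sum (mass m)     ≈⟨ solve 3 (λ c w s → c :* w :* s := w :* (c :* s)) refl κ w (sum (mass m)) ⟩
        w * (κ * sum (mass m))   ≤⟨ *-monoˡ-≤ 0≤w (partial-bound 𝔼X≤u 𝔼Y≤v m) ⟩
        w * (u + v + ε)          ∎

  -- For κ ≤ 0 both expectation bounds are nonnegative. For κ > 0 the layers give κ ≤ u + v + ε for
  -- every ε = 1/(1 + k), and the error vanishes in the limit.
  𝔼-superadditive : ∀ {X Y κ u v} → Measurable X →
                    (∀ ω → 0# ≤ X ω) → (∀ ω → 0# ≤ Y ω) → (∀ ω → κ ≤ X ω + Y ω) →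
                    𝔼[ X ]≤ u → 𝔼[ Y ]≤ v → κ ≤ u + v
  𝔼-superadditive {κ = κ} mX 0≤X 0≤Y κ≤X+Y 𝔼X≤u 𝔼Y≤v with dec (κ ≤ 0#)
  ... | yes κ≤0 = ≤-trans κ≤0 (+-nonneg (𝔼≤-nonneg 𝔼X≤u) (𝔼≤-nonneg 𝔼Y≤v))
  ... | no  κ≰0 = ≤-closed λ k →
    Layers.total-bound (1/[1+]-positive k) mX 0≤X 0≤Y κ≤X+Y 𝔼X≤u 𝔼Y≤v κ≰0

-- Alternating costs and the optima against them.

alternate : {A : Set} → A → A → ℕ → A
alternate a b zero          = a
alternate a b (suc zero)    = b
alternate a b (suc (suc t)) = alternate a b t

module AlternatingCosts (em : ExcludedMiddle (lsuc 0ℓ)) (ℝ : CompleteOrderedField) {n : ℕ}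
                        (N : Convexity.Seminorm ℝ n) (D : Convexity.DecisionSpace ℝ n) where
  open CompleteOrderedField ℝ
  open OrderedField em ℝ
  open Convexity ℝ n
  open SOCO ℝ N D
  open Seminorm N
  open DecisionSpace D
  open OrderReasoning poset

  totalCost-nonneg : ∀ {T} (c : Vector Cost T) y → 0# ≤ totalCost c y
  totalCost-nonneg {T} c y = sum-nonneg {T} (λ t → cost-nonneg (c t) (y t))

  switchingCost-nonneg : ∀ {T} (y : Vector Decision T) → 0# ≤ switchingCost y
  switchingCost-nonneg {T} y = sum-nonneg {T} (λ t → nonneg _)

  totalCost≤penalizedCost : ∀ {α} → 0# ≤ α → ∀ {T} (c : Vector Cost T) y →
                            totalCost c y ≤ penalizedCost α c y
  totalCost≤penalizedCost {α} 0≤α c y = transpose-≤ (*-nonneg 0≤α (switchingCost-nonneg y))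
    (solve 2 (λ x s → x :+ s := x :+ s :+ :0) refl (totalCost c y) (α * switchingCost y))

  penalizedCost-nonneg : ∀ {α} → 0# ≤ α → ∀ {T} (c : Vector Cost T) y →
                         0# ≤ penalizedCost α c y
  penalizedCost-nonneg 0≤α c y = ≤-trans (totalCost-nonneg c y) (totalCost≤penalizedCost 0≤α c y)

  OPTs-≤ : ∀ c T x → OPTs c T ≤ totalCost (prefix c T) (λ _ → x)
  OPTs-≤ c T x = inf-≤ (λ v → Σ[ x ∈ Decision ] v ≈ totalCost (prefix c T) (λ _ → x))
    (λ v≈w (x , v≈) → x , trans (sym v≈w) v≈)
    (λ v (x , v≈) → ≤-trans (totalCost-nonneg (prefix c T) _) (≤-reflexive (sym v≈))) (x , refl)

  module _ {α : Carrier} (0≤α : 0# ≤ α) (c : CostSequence) (T : ℕ) (y : Vector Decision T) where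

    private
      Attained : Pred Carrier 0ℓ
      Attained v = Σ[ y ∈ Vector Decision T ] v ≈ penalizedCost α (prefix c T) y

      attained-nonneg : ∀ v → Attained v → 0# ≤ v
      attained-nonneg v (y , v≈) =
        ≤-trans (penalizedCost-nonneg 0≤α (prefix c T) y) (≤-reflexive (sym v≈))

    OPTd-≤ : OPTd α c T ≤ penalizedCost α (prefix c T) y
    OPTd-≤ = inf-≤ Attained (λ v≈w (y , v≈) → y , trans (sym v≈w) v≈) attained-nonneg (y , refl)

    OPTd-nonneg : 0# ≤ OPTd α c T
    OPTd-nonneg = inf-nonneg Attained (λ v≈w (y , v≈) → y , trans (sym v≈w) v≈) attained-nonneg (y , refl)

  switchingCost-≤ : ∀ {M} (z : ℕ → Decision) → ‖ proj₁ (z 0) -ᵥ 0ᵥ ‖ ≤ M →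
                    (∀ t → ‖ proj₁ (z (suc t)) -ᵥ proj₁ (z t) ‖ ≤ M) →
                    ∀ T → switchingCost (prefix z T) ≤ T · M
  switchingCost-≤ {M} z start step T = ≤-trans (sum-mono-≤ (bound T)) (≤-reflexive (sum-replicate T))
    where
    bound : ∀ T (t : Fin T) →
            ‖ proj₁ (prefix z T t) -ᵥ (0ᵥ ∷ (proj₁ ∘ prefix z T)) (inject₁ t) ‖ ≤ M
    bound (suc T) Fin.zero    = start
    -- The predecessor of entry `suc t` is looked up at `inject₁ t`, which has the same number as t.
    bound (suc T) (Fin.suc t) rewrite Fin.toℕ-inject₁ t = step (toℕ t)

  -- The maximum of an affine function and 0 is convex and nonnegative. It depends on the j-th
  -- coordinate alone, so its measurability along the decisions follows from the coordinatewise
  -- `decide-measurable`.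
  hinge : Fin n → Carrier → Carrier → Cost
  hinge j u w = record
    { cost        = λ x → h (proj₁ x j)
    ; cost-cong   = λ x≋y → ⊔-cong (+-congʳ (*-congˡ (x≋y j))) refl
    ; cost-nonneg = λ x → x≤y⊔x _ 0#
    ; cost-convex = λ {x} {y} {z} r 0≤r r≤1 z≋ → convex (proj₁ x j) (proj₁ y j) (proj₁ z j) r 0≤r r≤1 (z≋ j)
    }
    where
    h : Carrier → Carrier
    h a = (u * a + w) ⊔ 0#

    convex : ∀ a b d r → 0# ≤ r → r ≤ 1# → d ≈ r * a + (1# - r) * b →
             h d ≤ r * h a + (1# - r) * h b
    convex a b d r 0≤r r≤1 d≈ = ⊔-lub affine
      (+-nonneg (*-nonneg 0≤r (x≤y⊔x _ 0#)) (*-nonneg 0≤1-r (x≤y⊔x _ 0#)))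
      where
      0≤1-r : 0# ≤ 1# - r
      0≤1-r = transpose-≤ r≤1 (solve 1 (λ r → :0 :+ :1 := :1 :- r :+ r) refl r)

      affine : u * d + w ≤ r * h a + (1# - r) * h b
      affine = begin
        u * d + w
          ≈⟨ +-congʳ (*-congˡ d≈) ⟩
        u * (r * a + (1# - r) * b) + w
          ≈⟨ solve 5 (λ u w r a b → u :* (r :* a :+ (:1 :- r) :* b) :+ w :=
                        r :* (u :* a :+ w) :+ (:1 :- r) :* (u :* b :+ w)) refl u w r a b ⟩
        r * (u * a + w) + (1# - r) * (u * b + w)
          ≤⟨ +-mono-≤ (*-monoˡ-≤ 0≤r (x≤x⊔y _ 0#)) (*-monoˡ-≤ 0≤1-r (x≤x⊔y _ 0#)) ⟩
        r * h a + (1# - r) * h b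
          ∎

  -- The moves from 0 to q, from q to p and from p to q are all the steps that `path` makes, so the
  -- sum of their lengths bounds each. It is independent of κ, which may therefore be chosen in
  -- terms of it.
  excursion : Decision → Decision → Carrier
  excursion p q = ‖ proj₁ q -ᵥ 0ᵥ ‖ + (‖ proj₁ p -ᵥ proj₁ q ‖ + ‖ proj₁ q -ᵥ proj₁ p ‖)

  excursion-nonneg : ∀ p q → 0# ≤ excursion p q
  excursion-nonneg p q = +-nonneg (nonneg _) (+-nonneg (nonneg _) (nonneg _))

  -- The costs K (xⱼ − qⱼ)⁺ and K (pⱼ − xⱼ)⁺ vanish at q and p respectively, and
  -- their sum is at least κ everywhere.
  module _ (p q : Decision) (j : Fin n) (K κ : Carrier) (0≤κ : 0# ≤ κ)
           (scale : K * (proj₁ p j - proj₁ q j) ≈ κ) where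

    private
      pⱼ = proj₁ p j
      qⱼ = proj₁ q j

    -- Each is named after the point that it charges κ.
    costAtP costAtQ : Cost
    costAtP = hinge j K (- (K * qⱼ))
    costAtQ = hinge j (- K) (K * pⱼ)

    costs : CostSequence
    costs = alternate costAtP costAtQ

    -- The path starts at q, so that at every time it sits where the current cost vanishes.
    path : ℕ → Decision
    path = alternate q p

    private
      ⊔-κ : ∀ {x} → x ≈ κ → x ⊔ 0# ≈ κ
      ⊔-κ x≈κ = antisym (⊔-lub (≤-reflexive x≈κ) 0≤κ)
                        (≤-trans (≤-reflexive (sym x≈κ)) (x≤x⊔y _ 0#))

      ⊔-0 : ∀ {x} → x ≈ 0# → x ⊔ 0# ≈ 0#
      ⊔-0 x≈0 = antisym (⊔-lub (≤-reflexive x≈0) ≤-refl) (x≤y⊔x _ 0#)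

      costAtP-p : cost costAtP p ≈ κ
      costAtP-p = ⊔-κ (trans
        (solve 3 (λ k p q → k :* p :+ (:- (k :* q)) := k :* (p :- q)) refl K pⱼ qⱼ) scale)

      costAtP-q : cost costAtP q ≈ 0#
      costAtP-q = ⊔-0 (-‿inverseʳ (K * qⱼ))

      costAtQ-p : cost costAtQ p ≈ 0#
      costAtQ-p = ⊔-0 (solve 2 (λ k p → (:- k) :* p :+ k :* p := :0) refl K pⱼ)

      costAtQ-q : cost costAtQ q ≈ κ
      costAtQ-q = ⊔-κ (trans
        (solve 3 (λ k p q → (:- k) :* q :+ k :* p := k :* (p :- q)) refl K pⱼ qⱼ) scale)

    -- The slopes K and - K cancel: the affine parts add up to K (pⱼ - qⱼ) = κ at every x, and
    -- positive parts are no smaller.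
    costAtP+costAtQ : ∀ x → κ ≤ cost costAtP x + cost costAtQ x
    costAtP+costAtQ x = begin
      κ
        ≈⟨ scale ⟨
      K * (pⱼ - qⱼ)
        ≈⟨ solve 4 (λ k p q x → k :* (p :- q) :=
                      (k :* x :+ (:- (k :* q))) :+ ((:- k) :* x :+ k :* p)) refl K pⱼ qⱼ (proj₁ x j) ⟩
      (K * proj₁ x j + - (K * qⱼ)) + (- K * proj₁ x j + K * pⱼ)
        ≤⟨ +-mono-≤ (x≤x⊔y _ 0#) (x≤x⊔y _ 0#) ⟩
      cost costAtP x + cost costAtQ x
        ∎

    consecutive-costs : ∀ t x → κ ≤ cost (costs (suc t)) x + cost (costs t) x
    consecutive-costs zero          x = ≤-trans (costAtP+costAtQ x) (≤-reflexive (+-comm _ _))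
    consecutive-costs (suc zero)    x = costAtP+costAtQ x
    consecutive-costs (suc (suc t)) x = consecutive-costs t x

    path-cost : ∀ t → cost (costs t) (path t) ≈ 0#
    path-cost zero          = costAtP-q
    path-cost (suc zero)    = costAtQ-p
    path-cost (suc (suc t)) = path-cost t

    static-costs : ∀ t → cost (costs t) p + cost (costs t) q ≈ κ
    static-costs zero          = trans (+-cong costAtP-p costAtP-q) (+-identityʳ κ)
    static-costs (suc zero)    = trans (+-cong costAtQ-p costAtQ-q) (+-identityˡ κ)
    static-costs (suc (suc t)) = static-costs t

    -- Staying at p and staying at q together cost κ per step. Bounding one optimum by each avoids
    -- deciding which point is better.
    2OPTs-≤ : ∀ T → OPTs costs T + OPTs costs T ≤ T · κ
    2OPTs-≤ T = begin
      OPTs costs T + OPTs costs T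
        ≤⟨ +-mono-≤ (OPTs-≤ costs T p) (OPTs-≤ costs T q) ⟩
      sum (λ t → cost (prefix costs T t) p) + sum (λ t → cost (prefix costs T t) q)
        ≈⟨ ∑-distrib-+ (λ t → cost (prefix costs T t) p) (λ t → cost (prefix costs T t) q) ⟨
      sum (λ t → cost (prefix costs T t) p + cost (prefix costs T t) q)
        ≈⟨ sum-cong-≋ {T} (λ t → static-costs (toℕ t)) ⟩
      sum (replicate T κ)
        ≈⟨ sum-replicate T ⟩
      T · κ
        ∎

    path-start : ‖ proj₁ (path 0) -ᵥ 0ᵥ ‖ ≤ excursion p q
    path-start = transpose-≤ (+-nonneg (nonneg _) (nonneg _))
      (solve 2 (λ x y → x :+ y := x :+ y :+ :0) refl _ _)

    path-step : ∀ t → ‖ proj₁ (path (suc t)) -ᵥ proj₁ (path t) ‖ ≤ excursion p q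
    path-step zero = transpose-≤ (+-nonneg (nonneg (proj₁ q -ᵥ 0ᵥ)) (nonneg (proj₁ q -ᵥ proj₁ p)))
      (solve 3 (λ x y z → y :+ (x :+ z) := x :+ (y :+ z) :+ :0) refl _ _ _)
    path-step (suc zero) = transpose-≤ (+-nonneg (nonneg (proj₁ q -ᵥ 0ᵥ)) (nonneg (proj₁ p -ᵥ proj₁ q)))
      (solve 3 (λ x y z → z :+ (x :+ y) := x :+ (y :+ z) :+ :0) refl _ _ _)
    path-step (suc (suc t)) = path-step t

    OPTd-≤-path : ∀ {α} → 0# ≤ α → ∀ T → OPTd α costs T ≤ (T · 1#) * (α * excursion p q)
    OPTd-≤-path {α} 0≤α T = begin
      OPTd α costs T
        ≤⟨ OPTd-≤ 0≤α costs T (prefix path T) ⟩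
      totalCost (prefix costs T) (prefix path T) + α * switchingCost (prefix path T)
        ≤⟨ +-mono-≤ (≤-reflexive no-cost)
             (*-monoˡ-≤ 0≤α (switchingCost-≤ path path-start path-step T)) ⟩
      0# + α * (T · excursion p q)
        ≈⟨ +-congˡ (*-congˡ (·≈* T (excursion p q))) ⟩
      0# + α * ((T · 1#) * excursion p q)
        ≈⟨ solve 3 (λ a t d → :0 :+ a :* (t :* d) := t :* (a :* d)) refl α (T · 1#) (excursion p q) ⟩
      (T · 1#) * (α * excursion p q)
        ∎
      where
      no-cost : totalCost (prefix costs T) (prefix path T) ≈ 0#
      no-cost = trans (sum-cong-≋ {T} (λ t → path-cost (toℕ t))) (sum-replicate-zero T)

    -- Decision z (t + 1) meets the cost with index t + 1 in the first total and the cost with index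
    -- t in the second, and these two together charge at least κ.
    shifted-totalCost : ∀ (z : ℕ → Decision) T →
      T · κ ≤ totalCost (prefix costs (suc T)) (prefix z (suc T))
              + totalCost (prefix costs T) (prefix (z ∘ suc) T)
    shifted-totalCost z T = begin
      T · κ
        ≈⟨ sum-replicate T ⟨
      sum (replicate T κ)
        ≤⟨ sum-mono-≤ {T} (λ t → consecutive-costs (toℕ t) (z (suc (toℕ t)))) ⟩
      sum (λ t → next t + current t)
        ≈⟨ ∑-distrib-+ next current ⟩
      sum next + sum current
        -- The longer total has one more term, the cost of z 0; it has no partner and is
        -- nonnegative.
        ≤⟨ +-mono-≤ (transpose-≤ (cost-nonneg (costs 0) (z 0)) (solve 2 (λ x s → s :+ x := x :+ s :+ :0) refl _ _))
             ≤-refl ⟩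
      totalCost (prefix costs (suc T)) (prefix z (suc T)) + totalCost (prefix costs T) (prefix (z ∘ suc) T)
        ∎
      where
      next current : Vector Carrier T
      next    t = cost (costs (suc (toℕ t))) (z (suc (toℕ t)))
      current t = cost (costs (toℕ t)) (z (suc (toℕ t)))

    -- Expected costs of an online algorithm.

    module _ (A : Algorithm) where
      open Algorithm A
      open Expectation em ℝ randomness

      cost-measurable : ∀ t s → Measurable (λ ω → cost (costs t) (decisions costs ω s))
      cost-measurable t s = at t
        where
        hinge-measurable : ∀ u w → Measurable (λ ω → cost (hinge j u w) (decisions costs ω s))
        hinge-measurable u w = measurable-⊔ 0# (measurable-shift w
          (measurable-scale u (decide-measurable s (prefix costs s) j)))

        at : ∀ t → Measurable (λ ω → cost (costs t) (decisions costs ω s))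
        at zero          = hinge-measurable K (- (K * qⱼ))
        at (suc zero)    = hinge-measurable (- K) (K * pⱼ)
        at (suc (suc t)) = at t

      regret-vs-cost : ∀ i T {u v} → C[ i , 0# ] A ≤ u on costs until suc T →
                       C[ suc i , 1# ] A ≤ v on costs until T → T · κ ≤ u + v
      regret-vs-cost i T = 𝔼-superadditive
        -- With penalty 0 the switching term vanishes, so only the total cost has to be shown
        -- measurable, not the seminorm.
        (measurable-≈ (λ ω → sym (trans (+-congˡ (zeroˡ _)) (+-identityʳ _)))
          (measurable-sum {suc T} (λ t ω → cost-nonneg (costs (toℕ t)) _)
            (λ t → cost-measurable (toℕ t) (toℕ t ℕ.+ i))))
        (λ ω → penalizedCost-nonneg ≤-refl (prefix costs (suc T)) (regretted ω))
        (λ ω → penalizedCost-nonneg 0≤1 (prefix costs T) (penalized ω))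
        pointwise
        where
        regretted : ∀ ω → Vector Decision (suc T)
        regretted ω = prefix (λ t → decisions costs ω (t ℕ.+ i)) (suc T)

        penalized : ∀ ω → Vector Decision T
        penalized ω = prefix (λ t → decisions costs ω (t ℕ.+ suc i)) T

        realign : ∀ ω → totalCost (prefix costs T) (prefix (λ t → decisions costs ω (suc t ℕ.+ i)) T)
                        ≡ totalCost (prefix costs T) (penalized ω)
        -- The indices `suc t + i` and `t + suc i` agree only propositionally.
        realign ω = sum-cong-≗ {T} λ t →
          ≡.cong (λ s → cost (costs (toℕ t)) (decisions costs ω s)) (≡.sym (ℕ.+-suc (toℕ t) i))

        pointwise : ∀ ω → T · κ ≤ penalizedCost 0# (prefix costs (suc T)) (regretted ω)
                                  + penalizedCost 1# (prefix costs T) (penalized ω)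
        pointwise ω = ≤-trans (shifted-totalCost (λ t → decisions costs ω (t ℕ.+ i)) T)
          (+-mono-≤ (totalCost≤penalizedCost ≤-refl (prefix costs (suc T)) (regretted ω))
            (≤-trans (≤-reflexive (reflexive (realign ω)))
              (totalCost≤penalizedCost 0≤1 (prefix costs T) (penalized ω))))

-- Choice of the constants and the dichotomy.

module Incompatibility (em : ExcludedMiddle (lsuc 0ℓ)) (ℝ : CompleteOrderedField) {n : ℕ}
                       (N : Convexity.Seminorm ℝ n) (D : Convexity.DecisionSpace ℝ n) where
  open CompleteOrderedField ℝ
  open OrderedField em ℝ
  open Convexity ℝ n
  open SOCO ℝ N D
  open AlternatingCosts em ℝ N D

  separating-coordinate : Nontrivial D →
    Σ[ p ∈ Decision ] Σ[ q ∈ Decision ] Σ[ j ∈ Fin n ] ¬ (proj₁ p j - proj₁ q j ≈ 0#)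
  separating-coordinate (x , y , Fx , Fy , x≉y) =
    (x , Fx) , (y , Fy) , by-contradiction λ none → x≉y λ j →
      let x-y≈0 = by-contradiction λ x-y≉0 → none (j , x-y≉0)
      in trans (solve 2 (λ x y → x := x :- y :+ y) refl (x j) (y j))
               (trans (+-congʳ x-y≈0) (+-identityˡ (y j)))

  -- With L = (1 + γ)(1 + β) and κ = 4 L these are the concluding estimates, where
  -- t stands for T, o for OPTs, r for ρ, d for OPTd and v for a bound on the cost.
  cost-estimate : ∀ {t L o r v} → let κ = (L + L) + (L + L) in
    t * κ ≤ o + r + v → o + o ≤ κ + t * κ → r ≤ L + t * L → t * L ≤ v + (L + L + L)
  -- Doubling gives 8 t L ≤ 2 o + 2 r + 2 v ≤ (4 L + 4 t L) + (2 L + 2 t L) + 2 v, that is 2 t L ≤ 2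
  -- v + 6 L.
  cost-estimate {t} {L} {o} {r} {v} tκ≤ 2o≤ r≤ = halve-≤ (transpose-≤
    (+-mono-≤ (+-mono-≤ tκ≤ tκ≤) (+-mono-≤ 2o≤ (+-mono-≤ r≤ r≤)))
    (solve 5 (λ t l o r v →
       let k = (l :+ l) :+ (l :+ l)
           w = v :+ (l :+ l :+ l)
       in (t :* l :+ t :* l)
            :+ (((o :+ r :+ v) :+ (o :+ r :+ v))
                :+ ((k :+ t :* k) :+ ((l :+ t :* l) :+ (l :+ t :* l))))
          := (w :+ w) :+ ((t :* k :+ t :* k) :+ ((o :+ o) :+ (r :+ r))))
      refl t L o r v))

  module _ {γ β : Carrier} (0≤γ : 0# ≤ γ) (0≤β : 0# ≤ β) where

    private
      L = (1# + γ) * (1# + β)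

    -- As d ≥ 0, r d ≤ γ d ≤ t γ β. Expanding L = 1 + γ + β + γ β, the summand t γ β of t L absorbs
    -- this term and the summand t remains.
    ratio-estimate : ∀ {t d r k} → 0# ≤ t → 0# ≤ d → r ≤ γ →
      t * L ≤ r * d + k + (L + L + L) → d ≤ t * β → t ≤ k + (L + L + L)
    ratio-estimate {t} {d} {r} {k} 0≤t 0≤d r≤γ cost≥ d≤ = transpose-≤
      (+-mono-≤ (+-mono-≤ cost≥ (*-monoˡ-≤ 0≤d r≤γ))
                (+-mono-≤ (*-monoˡ-≤ 0≤γ d≤) (*-nonneg 0≤t (+-nonneg 0≤γ 0≤β))))
      (solve 6 (λ t g b d r k →
         let l = (:1 :+ g) :* (:1 :+ b)
             l3 = l :+ l :+ l
         in t :+ (((r :* d :+ k) :+ l3 :+ d :* g) :+ (g :* (t :* b) :+ t :* (g :+ b)))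
            := (k :+ l3) :+ ((t :* l :+ d :* r) :+ (g :* d :+ :0)))
        refl t γ β d r k)

    -- In the expansion of t L, the summand t β absorbs d and the summand t absorbs 3 L; t γ remains
    -- for r.
    difference-estimate : ∀ {t d r} → L + L + L ≤ t →
      t * L ≤ d + r + (L + L + L) → d ≤ t * β → t * γ ≤ r
    difference-estimate {t} {d} {r} 3L≤t cost≥ d≤ = transpose-≤
      (+-mono-≤ (+-mono-≤ cost≥ d≤) (+-mono-≤ 3L≤t (*-nonneg 0≤t (*-nonneg 0≤γ 0≤β))))
      (solve 5 (λ t g b d r →
         let l = (:1 :+ g) :* (:1 :+ b)
             l3 = l :+ l :+ l
         in t :* g :+ (((d :+ r) :+ l3 :+ t :* b) :+ (t :+ t :* (g :* b)))
            := r :+ ((t :* l :+ d) :+ (l3 :+ :0)))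
        refl t γ β d r)
      where
      0≤L : 0# ≤ L
      0≤L = *-nonneg (+-nonneg 0≤1 0≤γ) (+-nonneg 0≤1 0≤β)
      0≤t : 0# ≤ t
      0≤t = ≤-trans (+-nonneg (+-nonneg 0≤L 0≤L) 0≤L) 3L≤t

  module _ (p q : Decision) (j : Fin n) (pⱼ≉qⱼ : ¬ (proj₁ p j - proj₁ q j ≈ 0#))
           {γ α : Carrier} (0≤γ : 0# ≤ γ) (0≤α : 0# ≤ α) where

    private
      gap = proj₁ p j - proj₁ q j
      1/gap = inverse gap pⱼ≉qⱼ

      β L : Carrier
      β = α * excursion p q
      L = (1# + γ) * (1# + β)

      0≤β : 0# ≤ β
      0≤β = *-nonneg 0≤α (excursion-nonneg p q)

      1≤L : 1# ≤ L
      1≤L = transpose-≤ (+-nonneg (+-nonneg 0≤γ 0≤β) (*-nonneg 0≤γ 0≤β))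
        (solve 2 (λ g b → :1 :+ (g :+ b :+ g :* b) := (:1 :+ g) :* (:1 :+ b) :+ :0) refl γ β)

      κ K : Carrier
      -- Of κ T, the static optimum takes about half and a regret of at most L T a quarter, which
      -- leaves about L T for the cost.
      κ = (L + L) + (L + L)
      -- K inherits the sign of pⱼ - qⱼ, so both orders of the two coordinates are covered at once.
      K = κ * proj₁ 1/gap

      0≤L : 0# ≤ L
      0≤L = ≤-trans 0≤1 1≤L

      0≤κ : 0# ≤ κ
      0≤κ = +-nonneg (+-nonneg 0≤L 0≤L) (+-nonneg 0≤L 0≤L)

      scale : K * gap ≈ κ
      scale = trans (solve 3 (λ k w d → k :* w :* d := k :* (d :* w)) refl κ (proj₁ 1/gap) gap)
                    (trans (*-congˡ (proj₂ 1/gap)) (*-identityʳ κ))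

    incompatibleCosts : CostSequence
    incompatibleCosts = costs p q j K κ 0≤κ scale

    private
      c = incompatibleCosts

    0<L : 0# < L
    0<L = 0≤L , λ 0≈L → 1≰0 (≤-trans 1≤L (≤-reflexive (sym 0≈L)))

    module _ (A : Algorithm) (i : ℕ) where

      -- The guarantee is evaluated at T + 1, since the regret is taken over one step more than the
      -- cost.
      cost-≥ : ∀ {ρ : ℕ → Carrier} → Regret≤ i ｛ c ｝ A ρ →
               ∀ T → ρ (suc T) ≤ suc T · L → ∀ {v} → C[ suc i , 1# ] A ≤ v on c until T →
               (T · 1#) * L ≤ v + (L + L + L)
      cost-≥ {ρ} regret T ρ≤ {v} cost≤v = cost-estimate κT≤ 2OPT≤ ρ≤′
        where
        κT≤ : (T · 1#) * κ ≤ OPTs c (suc T) + ρ (suc T) + v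
        κT≤ = ≤-trans (≤-reflexive (sym (·≈* T κ)))
          (regret-vs-cost p q j K κ 0≤κ scale A i T (regret c ≡.refl (suc T)) cost≤v)

        2OPT≤ : OPTs c (suc T) + OPTs c (suc T) ≤ κ + (T · 1#) * κ
        2OPT≤ = ≤-trans (2OPTs-≤ p q j K κ 0≤κ scale (suc T)) (+-mono-≤ ≤-refl (≤-reflexive (·≈* T κ)))

        ρ≤′ : ρ (suc T) ≤ L + (T · 1#) * L
        ρ≤′ = ≤-trans ρ≤ (+-mono-≤ ≤-refl (≤-reflexive (·≈* T L)))

      module _ {ρ : ℕ → Carrier} (regret : Regret≤ i ｛ c ｝ A ρ) (T₁ : ℕ)
               (ρ≤ : ∀ T → T₁ ℕ.≤ T → ρ T ≤ T · L) where

        private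
          cost-≥′ : ∀ {T} → T₁ ℕ.≤ T → ∀ {v} → C[ suc i , 1# ] A ≤ v on c until T →
                    (T · 1#) * L ≤ v + (L + L + L)
          cost-≥′ {T} T₁≤T = cost-≥ regret T (ρ≤ (suc T) (ℕ.m≤n⇒m≤1+n T₁≤T))

          OPTd-≤′ : ∀ T → OPTd α c T ≤ (T · 1#) * β
          OPTd-≤′ = OPTd-≤-path p q j K κ 0≤κ scale 0≤α

          eventually : ∀ x → ∃[ T₀ ] ∀ T → T₀ ℕ.≤ T → T₁ ℕ.≤ T × ¬ (T · 1# ≤ x)
          eventually x = T₁ ℕ.+ T₂ , λ T T₀≤T → ℕ.m+n≤o⇒m≤o T₁ T₀≤T , λ T≤x →
            proj₂ far (≤-trans (·-monoˡ-≤ 0≤1 (ℕ.m+n≤o⇒n≤o T₁ T₀≤T)) T≤x)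
            where
            far = archimedean x 1≰0
            T₂ = proj₁ far

        -- The additive constant k of the ratio is fixed before T₀, so T₀ can be taken with T > k +
        -- 3 L from there on; then r T ≤ γ would contradict `ratio-estimate`.
        competitive-ratio : BestEventually≥ (CR≤ (suc i) α ｛ c ｝ A) (λ _ → γ)
        competitive-ratio r (k , CR) = T₀ , λ T T₀≤T → by-contradiction λ γ≰r →
          proj₂ (late T T₀≤T) (too-early T (proj₁ (late T T₀≤T)) (≰⇒≥ γ≰r))
          where
          T₀   = proj₁ (eventually (k + (L + L + L)))
          late = proj₂ (eventually (k + (L + L + L)))

          too-early : ∀ T → T₁ ℕ.≤ T → r T ≤ γ → T · 1# ≤ k + (L + L + L)
          too-early T T₁≤T r≤γ = ratio-estimate 0≤γ 0≤β (·-nonneg T 0≤1)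
            (OPTd-nonneg 0≤α c T (λ _ → p)) r≤γ (cost-≥′ T₁≤T (CR c ≡.refl T)) (OPTd-≤′ T)

        competitive-difference : BestEventually≥ (CD≤ (suc i) α ｛ c ｝ A) (λ T → T · γ)
        competitive-difference r CD = T₀ , λ T T₀≤T →
          ≤-trans (≤-reflexive (·≈* T γ)) (bound T (proj₁ (late T T₀≤T)) (≰⇒≥ (proj₂ (late T T₀≤T))))
          where
          T₀   = proj₁ (eventually (L + L + L))
          late = proj₂ (eventually (L + L + L))

          bound : ∀ T → T₁ ℕ.≤ T → L + L + L ≤ T · 1# → (T · 1#) * γ ≤ r T
          bound T T₁≤T 3L≤T =
            difference-estimate 0≤γ 0≤β 3L≤T (cost-≥′ T₁≤T (CD c ≡.refl T)) (OPTd-≤′ T)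

      dichotomy : BestΩT (Regret≤ i ｛ c ｝ A)
                  ⊎ (BestEventually≥ (CR≤ (suc i) α ｛ c ｝ A) (λ _ → γ)
                     × BestEventually≥ (CD≤ (suc i) α ｛ c ｝ A) (λ T → T · γ))
      dichotomy = decide-regret em
        where
        EventuallySmallRegret : Set₁
        EventuallySmallRegret = ∃[ ρ ] Regret≤ i ｛ c ｝ A ρ × ∃[ T₁ ] (∀ T → T₁ ℕ.≤ T → ρ T ≤ T · L)

        decide-regret : Dec EventuallySmallRegret → _
        decide-regret (yes (ρ , regret , T₁ , ρ≤)) =
          inj₂ (competitive-ratio regret T₁ ρ≤ , competitive-difference regret T₁ ρ≤)
        -- Here ε = L works: a guarantee ρ that stayed below L T from some T₀ on would be an
        -- instance of eventually small regret.
        decide-regret (no none) = inj₁ (L , 0<L , λ ρ regret T₀ → by-contradiction λ small →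
          none (ρ , regret , T₀ , λ T T₀≤T → ≰⇒≥ λ TL≤ρ → small (T , T₀≤T , TL≤ρ)))

theorem1 : ExcludedMiddle (lsuc 0ℓ) →
    (ℝ : CompleteOrderedField) →
    let open CompleteOrderedField ℝ in
    (n : ℕ) →
    let open Convexity ℝ n in
    (N : Seminorm) (D : DecisionSpace) → Nontrivial D →
    let open SOCO ℝ N D in
    (γ α : Carrier) → 0# < γ → 1# ≤ α → (i : ℕ) →
    Σ[ c ∈ CostSequence ] ((A : Algorithm) →
    BestΩT (Regret≤ i ｛ c ｝ A)
    ⊎ (BestEventually≥ (CR≤ (suc i) α ｛ c ｝ A) (λ _ → γ)
    × BestEventually≥ (CD≤ (suc i) α ｛ c ｝ A) (λ T → T · γ)))
theorem1 em ℝ n N D nontrivial γ α (0≤γ , _) 1≤α i =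
  let p , q , j , pⱼ≉qⱼ = separating-coordinate nontrivial
      0≤α = ≤-trans 0≤1 1≤α
  in incompatibleCosts p q j pⱼ≉qⱼ 0≤γ 0≤α , λ A → dichotomy p q j pⱼ≉qⱼ 0≤γ 0≤α A i
  where
  open OrderedField em ℝ
  open Incompatibility em ℝ N D
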